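{- Let $G$ and $H$ be two even-regular graphs (each regular, of even degree) such that each of them admits a neighborhood balanced coloring and each admits a local distance antimagic labeling. Then $\chi_{ld}(G\times H)\leq \min\{\chi_{ld}(G), \chi_{ld}(H)\}$.
   Context: All graphs are finite, simple, undirected and without isolated vertices. For a graph $G$ of order $n$ and a bijection $f\colon V(G)\to\{1,2,\dots,n\}$, the weight of a vertex $u$ is $w_f(u)=\sum_{x\in N(u)}f(x)$, where $N(u)$ is the open neighborhood of $u$. The bijection $f$ is a local distance antimagic labeling of $G$ if $w_f(u)\neq w_f(v)$ for every edge $uv$ of $G$. The local distance antimagic chromatic number $\chi_{ld}(G)$ is the minimum number of distinct weights over all local distance antimagic labelings of $G$ (an upper bound on $\chi_{ld}$ includes the assertion that such a labeling exists). A neighborhood balanced coloring of a graph is an assignment of one of two colors to each vertex (not necessarily proper) such that every vertex has equally many neighbors of each color. The direct product $G\times H$ has vertex set $V(G)\times V(H)$, with $(g,h)$ and $(g',h')$ adjacent iff $gg'\in E(G)$ and $hh'\in E(H)$. -}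

module Defs where

open import Level using (0ℓ)
open import Data.Bool using (Bool; true; false)
import Data.Bool as Bool
open import Data.Fin using (Fin; toℕ; finToFun; funToFin)
import Data.Fin as Fin
open import Data.Fin.Properties using (*↔×; all?; any?; finToFun-funToFin)
open import Data.List using (List; map; filter; length; sum; allFin; deduplicate)
open import Data.List.Properties using (map-cong)
open import Data.Nat using (ℕ; suc; _≤_; _<_)
import Data.Nat as ℕ
open import Data.Nat.Divisibility using (_∣_)
open import Data.Nat.Properties using (≮⇒≥; anyUpTo?)
open import Data.Nat.Induction using (<-rec)
open import Data.Product using (Σ-syntax; ∃-syntax; _×_; _,_; proj₁; proj₂)
open import Data.Product.Function.NonDependent.Propositional using (_×-↔_)
open import Function using (_∘_)
open import Function.Bundles using (_↔_; _⤖_; mk⤖; Inverse; Bijection)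
open import Function.Consequences.Propositional using (strictlySurjective⇒surjective)
open import Function.Construct.Composition using (_↔-∘_)
open import Relation.Binary using (Rel; Decidable; Symmetric)
open import Relation.Binary.PropositionalEquality
  using (_≡_; _≢_; refl; sym; trans; cong; subst; subst₂; _≗_)
open import Relation.Nullary using (¬_; Dec; yes; no; ¬?)
open import Relation.Nullary.Decidable using (map′; _×-dec_; _→-dec_)
import Relation.Unary as Unary

record Graph : Set₁ where
  field
    Vertex      : Set
    order       : ℕ
    enumeration : Fin order ↔ Vertex
    Adj         : Rel Vertex 0ℓ
    adj?        : Decidable Adj
    adj-sym     : Symmetric Adj
    adj-irrefl  : ∀ v → ¬ Adj v v
    no-isolated : ∀ u → ∃[ v ] Adj u v

  vertices : List Vertex
  vertices = map (Inverse.to enumeration) (allFin order)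

  neighbors : Vertex → List Vertex
  neighbors u = filter (adj? u) vertices

  degree : Vertex → ℕ
  degree u = length (neighbors u)

  weight : (Vertex → ℕ) → Vertex → ℕ
  weight f u = sum (map f (neighbors u))

  #weights : (Vertex → ℕ) → ℕ
  #weights f = length (deduplicate ℕ._≟_ (map (weight f) vertices))

open Graph

infixr 7 _×ᵍ_

_×ᵍ_ : Graph → Graph → Graph
G ×ᵍ H = record
  { Vertex      = Vertex G × Vertex H
  ; order       = order G ℕ.* order H
  ; enumeration = (enumeration G ×-↔ enumeration H) ↔-∘ *↔×
  ; Adj         = λ (g , h) (g′ , h′) → Adj G g g′ × Adj H h h′
  ; adj?        = λ (g , h) (g′ , h′) → adj? G g g′ ×-dec adj? H h h′
  ; adj-sym     = λ (a , b) → adj-sym G a , adj-sym H b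
  ; adj-irrefl  = λ (g , _) (a , _) → adj-irrefl G g a
  ; no-isolated = λ (g , h) →
      let (g′ , a) = no-isolated G g
          (h′ , b) = no-isolated H h
      in (g′ , h′) , (a , b)
  }

EvenRegular : Graph → Set
EvenRegular G = ∃[ r ] (2 ∣ r × ∀ u → degree G u ≡ r)

NeighborhoodBalancedColoring : Graph → Set
NeighborhoodBalancedColoring G =
  Σ[ c ∈ (Vertex G → Bool) ] ∀ u → #neighbors c true u ≡ #neighbors c false u
  where
  #neighbors : (Vertex G → Bool) → Bool → Vertex G → ℕ
  #neighbors c b u = length (filter (λ v → c v Bool.≟ b) (neighbors G u))

-- Fin n is {0,…,n-1}; the labels are {1,…,n}.
toLabel : ∀ {V : Set} {n} → (V → Fin n) → V → ℕ
toLabel f v = suc (toℕ (f v))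

ProperWeights : (G : Graph) → (Vertex G → ℕ) → Set
ProperWeights G f = ∀ u v → Adj G u v → weight G f u ≢ weight G f v

record LDALabeling (G : Graph) : Set where
  field
    bijection : Vertex G ⤖ Fin (order G)

  label : Vertex G → ℕ
  label = toLabel (Bijection.to bijection)

  field
    proper : ProperWeights G label

open LDALabeling

#labelingWeights : (G : Graph) → LDALabeling G → ℕ
#labelingWeights G f = #weights G (label f)

IsLDAChromaticNumber : Graph → ℕ → Set
IsLDAChromaticNumber G k =
  (∃[ f ] #labelingWeights G f ≡ k) × (∀ f → k ≤ #labelingWeights G f)

-- The minimum exists as soon as there is one labeling: there are finitely many
-- maps Fin n → Fin n, so it is decidable whether k weights can be achieved.
module _ (G : Graph) where
  private
    n : ℕ
    n = order G

    open Inverse (enumeration G) using (to; from; strictlyInverseˡ; strictlyInverseʳ)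

    all-vertices? : {P : Vertex G → Set} → Unary.Decidable P → Dec (∀ v → P v)
    all-vertices? {P} P? =
      map′ (λ p v → subst P (strictlyInverseˡ v) (p (from v))) (λ p i → p (to i))
           (all? (P? ∘ to))

    weight-cong : ∀ {f g} → f ≗ g → weight G f ≗ weight G g
    weight-cong eq u = cong sum (map-cong eq (neighbors G u))

    #weights-cong : ∀ {f g} → f ≗ g → #weights G f ≡ #weights G g
    #weights-cong eq =
      cong (length ∘ deduplicate ℕ._≟_) (map-cong (weight-cong eq) (vertices G))

    proper-cong : ∀ {f g} → f ≗ g → ProperWeights G f → ProperWeights G g
    proper-cong eq p u v a =
      subst₂ _≢_ (weight-cong eq u) (weight-cong eq v) (p u v a)

    proper? : Unary.Decidable (ProperWeights G)
    proper? f = all-vertices? λ u → all-vertices? λ v →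
      adj? G u v →-dec ¬? (weight G f u ℕ.≟ weight G f v)

    Good : ℕ → (Fin n → Fin n) → Set
    Good k p =
      (∀ i j → p i ≡ p j → i ≡ j) × (∀ j → ∃[ i ] p i ≡ j) ×
      ProperWeights G (toLabel (p ∘ from)) × #weights G (toLabel (p ∘ from)) ≡ k

    good? : ∀ k → Unary.Decidable (Good k)
    good? k p =
      all? (λ i → all? λ j → (p i Fin.≟ p j) →-dec (i Fin.≟ j)) ×-dec
      all? (λ j → any? λ i → p i Fin.≟ j) ×-dec
      proper? _ ×-dec (_ ℕ.≟ k)

    Achieved : ℕ → Set
    Achieved k = ∃[ f ] #labelingWeights G f ≡ k

    fromGood : ∀ {k p} → Good k p → Achieved k
    fromGood {p = p} (inj , surj , prop , eq) = record
      { bijection = mk⤖ {to = p ∘ from}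
          ( (λ {u} {v} e → trans (sym (strictlyInverseˡ u))
              (trans (cong to (inj _ _ e)) (strictlyInverseˡ v)))
          , strictlySurjective⇒surjective λ j →
              to (proj₁ (surj j)) ,
              trans (cong p (strictlyInverseʳ _)) (proj₂ (surj j)) )
      ; proper = prop } , eq

    code : LDALabeling G → Fin (n ℕ.^ n)
    code f = funToFin (Bijection.to (bijection f) ∘ to)

    toGood : ∀ {k} → (a : Achieved k) → Good k (finToFun (code (proj₁ a)))
    toGood (f , eq) =
        (λ i j e → trans (sym (strictlyInverseʳ i)) (trans
          (cong from (B.injective (trans (sym (q i)) (trans e (q j)))))
          (strictlyInverseʳ j)))
      , (λ j → let (v , e) = B.strictlySurjective j in
          from v , trans (q (from v)) (trans (cong B.to (strictlyInverseˡ v)) e))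
      , proper-cong label-eq (proper f)
      , trans (sym (#weights-cong label-eq)) eq
      where
      module B = Bijection (bijection f)
      q : finToFun (code f) ≗ B.to ∘ to
      q = finToFun-funToFin (B.to ∘ to)
      label-eq : label f ≗ toLabel (finToFun (code f) ∘ from)
      label-eq v = cong (suc ∘ toℕ)
        (sym (trans (q (from v)) (cong B.to (strictlyInverseˡ v))))

    achieved? : Unary.Decidable Achieved
    achieved? k = map′ (fromGood ∘ proj₂) (λ a → _ , toGood a) (any? (good? k ∘ finToFun))

  ldaChromaticNumber-exists : LDALabeling G → ∃[ k ] IsLDAChromaticNumber G k
  ldaChromaticNumber-exists f = <-rec P step _ (f , refl)
    where
    P : ℕ → Set
    P k = Achieved k → ∃[ m ] IsLDAChromaticNumber G m
    step : ∀ k → (∀ {j} → j < k → P j) → P k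
    step k rec a with anyUpTo? achieved? k
    ... | yes (j , j<k , b) = rec j<k b
    ... | no none = k , a , λ g → ≮⇒≥ λ lt → none (_ , lt , (g , refl))

  -- The labeling only witnesses that the minimum exists; by antisymmetry of ≤
  -- the value does not depend on it.
  χld : LDALabeling G → ℕ
  χld f = proj₁ (ldaChromaticNumber-exists f)

{-# OPTIONS --safe #-}

-- Write m = |H| and let c be a balanced coloring of G.  Blow each label a of a labeling f
-- of G up to a block of m consecutive labels: the vertices (x , y) with f x = a receive the
-- block in increasing or in decreasing order of y according to c x.  A neighborhood of (x , y)
-- pairs increasing with decreasing positions, so the positions inside the blocks contribute
-- the same amount everywhere, and the weight of (x , y) is a fixed injective affine function
-- of the weight of x.  Exchanging the factors gives the bound for H.
module Submission where

open import Defs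
open import Data.Bool using (Bool; true; false)
import Data.Bool as Bool
open import Data.Fin using (Fin; toℕ; opposite)
open import Data.Fin.Permutation using (cast-id; ↔⇒≡)
open import Data.Fin.Properties
  using (*↔×; toℕ-combine; toℕ-cast; toℕ<n; opposite-prop; opposite-involutive)
open import Data.List
  using (List; []; _∷_; _++_; map; filter; length; allFin; deduplicate; cartesianProduct)
open import Data.List.Membership.Propositional using (_∈_)
open import Data.List.Membership.Propositional.Properties
  using (∈-map⁺; ∈-map⁻; ∈-filter⁺; ∈-filter⁻; ∈-allFin; ∈-length; ∈-∃++
        ; ∈-cartesianProduct⁺; ∈-cartesianProduct⁻; ∈-deduplicate⁺; ∈-deduplicate⁻)
open import Data.List.Membership.Propositional.Properties.WithK using (unique∧set⇒bag)
open import Data.List.Properties using (map-cong; map-∘; map-++; length-map)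
open import Data.List.Relation.Binary.BagAndSetEquality using (∼bag⇒↭)
open import Data.List.Relation.Binary.Permutation.Propositional using (_↭_)
open import Data.List.Relation.Binary.Permutation.Propositional.Properties
  using (shift; ↭-length; ∈-resp-↭) renaming (map⁺ to ↭-map⁺)
open import Data.List.Relation.Binary.Subset.Propositional using (_⊆_)
open import Data.List.Relation.Unary.Any using (here; there)
open import Data.List.Relation.Unary.AllPairs using (_∷_)
open import Data.List.Relation.Unary.Unique.Propositional using (Unique)
import Data.List.Relation.Unary.Unique.Propositional.Properties as Unique
open import Data.List.Relation.Unary.Unique.DecPropositional.Properties using (deduplicate-!)
open import Data.Nat using (ℕ; suc; _+_; _*_; _∸_; _≤_; _⊓_; z≤n; s≤s; NonZero; >-nonZero)
import Data.Nat as ℕ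
open import Data.Nat.Divisibility using (divides)
open import Data.Nat.ListAction using (sum)
open import Data.Nat.ListAction.Properties using (sum-++; sum-↭)
open import Data.Nat.Properties
open import Data.Nat.Tactic.RingSolver using (solve-∀)
open import Data.Product using (Σ-syntax; ∃-syntax; _×_; _,_; proj₁; proj₂)
open import Data.Product.Algebra using (×-comm)
open import Data.Product.Function.NonDependent.Propositional using (_×-↔_)
open import Function using (_∘_; _⇔_; mk⇔; Equivalence)
open import Function.Bundles using (_↔_; mk↔ₛ′; Inverse; Bijection; Injection)
open import Function.Construct.Composition using (_↔-∘_)
open import Function.Construct.Identity using (↔-id)
open import Function.Construct.Symmetry using (↔-sym)
open import Function.Properties.Bijection using (⤖⇒↔)
open import Function.Properties.Inverse using (↔⇒⤖; ↔⇒↣)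
open import Relation.Binary.PropositionalEquality
  using (_≡_; refl; sym; trans; cong; cong₂; subst; module ≡-Reasoning)
open import Relation.Nullary using (contradiction)
open import Algebra.Properties.CommutativeSemigroup +-commutativeSemigroup
  using (interchange; x∙yz≈y∙xz)

open Graph
open LDALabeling

-- Sums over finite lists

private variable
  A B : Set

sum-map-+ : (f g : A → ℕ) (xs : List A) →
            sum (map (λ x → f x + g x) xs) ≡ sum (map f xs) + sum (map g xs)
sum-map-+ f g []       = refl
sum-map-+ f g (x ∷ xs) = trans (cong (f x + g x +_) (sum-map-+ f g xs))
                               (interchange (f x) (g x) _ _)

sum-map-* : (a : ℕ) (f : A → ℕ) (xs : List A) →
            sum (map (λ x → a * f x) xs) ≡ a * sum (map f xs)
sum-map-* a f []       = sym (*-zeroʳ a)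
sum-map-* a f (x ∷ xs) =
  trans (cong (a * f x +_) (sum-map-* a f xs)) (sym (*-distribˡ-+ a (f x) _))

sum-map-const : (a : ℕ) (xs : List A) → sum (map (λ _ → a) xs) ≡ length xs * a
sum-map-const a []       = refl
sum-map-const a (x ∷ xs) = cong (a +_) (sum-map-const a xs)

sum-cartesianProduct : (f : A × B → ℕ) (xs : List A) (ys : List B) →
  sum (map f (cartesianProduct xs ys)) ≡ sum (map (λ x → sum (map (λ y → f (x , y)) ys)) xs)
sum-cartesianProduct f []       ys = refl
sum-cartesianProduct f (x ∷ xs) ys = begin
  sum (map f (map (x ,_) ys ++ zs))              ≡⟨ cong sum (map-++ f (map (x ,_) ys) zs) ⟩
  sum (map f (map (x ,_) ys) ++ map f zs)        ≡⟨ sum-++ (map f (map (x ,_) ys)) _ ⟩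
  sum (map f (map (x ,_) ys)) + sum (map f zs)
    ≡⟨ cong₂ _+_ (cong sum (sym (map-∘ ys))) (sum-cartesianProduct f xs ys) ⟩
  sum (map (λ y → f (x , y)) ys) + sum (map (λ x → sum (map (λ y → f (x , y)) ys)) xs) ∎
  where
  open ≡-Reasoning
  zs = cartesianProduct xs ys

-- Counts and sums split by color

count : (A → Bool) → Bool → List A → ℕ
count c b xs = length (filter (λ x → c x Bool.≟ b) xs)

length-by-color : (c : A → Bool) (xs : List A) →
                  length xs ≡ count c true xs + count c false xs
length-by-color c []       = refl
length-by-color c (x ∷ xs) with c x
... | true  = cong suc (length-by-color c xs)
... | false = trans (cong suc (length-by-color c xs)) (sym (+-suc _ _))

sum-by-color : (c : A → Bool) (t : Bool → ℕ) (xs : List A) →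
  sum (map (t ∘ c) xs) ≡ count c true xs * t true + count c false xs * t false
sum-by-color c t []       = refl
sum-by-color c t (x ∷ xs) with c x
... | true  = trans (cong (t true +_) (sum-by-color c t xs)) (sym (+-assoc (t true) _ _))
... | false = trans (cong (t false +_) (sum-by-color c t xs))
                    (x∙yz≈y∙xz (t false) (count c true xs * t true) _)

-- Comparing numbers of distinct values

unique-⊆⇒length-≤ : {xs ys : List A} → Unique xs → xs ⊆ ys → length xs ≤ length ys
unique-⊆⇒length-≤ {xs = []}               _              _   = z≤n
unique-⊆⇒length-≤ {xs = x ∷ xs} {ys} u@(_ ∷ u′) sub
  -- One occurrence of `x` is cut out of `ys`. By uniqueness `x` does not recur in `xs`, so the
  -- remaining entries all lie in `as ++ bs` and the induction hypothesis applies there.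
  with as , bs , refl ← ∈-∃++ (sub (here refl)) =
  ≤-trans (s≤s (unique-⊆⇒length-≤ u′ sub′)) (≤-reflexive (sym (↭-length (shift x as bs))))
  where
  sub′ : xs ⊆ as ++ bs
  sub′ z∈xs with ∈-resp-↭ (shift x as bs) (sub (there z∈xs))
  ... | here refl = contradiction z∈xs (Unique.Unique[x∷xs]⇒x∉xs u)
  ... | there z∈  = z∈

-- Every value of `f` on `xs` is the `φ`-image of a value of `g` on `ys`, and applying `φ` to a list
-- keeps its length. This is how weights are counted, both under an isomorphism (`φ` the identity)
-- and for the blown-up labeling (`φ` affine, `π` the projection).
#distinct-≤ : (f : A → ℕ) (g : B → ℕ) (φ : ℕ → ℕ) (π : A → B) (xs : List A) (ys : List B) →
  (∀ {x} → x ∈ xs → π x ∈ ys) → (∀ x → f x ≡ φ (g (π x))) →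
  length (deduplicate ℕ._≟_ (map f xs)) ≤ length (deduplicate ℕ._≟_ (map g ys))
#distinct-≤ f g φ π xs ys π∈ f≡ = ≤-trans
  (unique-⊆⇒length-≤ (deduplicate-! ℕ._≟_ (map f xs)) sub)
  (≤-reflexive (length-map φ (deduplicate ℕ._≟_ (map g ys))))
  where
  sub : deduplicate ℕ._≟_ (map f xs) ⊆ map φ (deduplicate ℕ._≟_ (map g ys))
  sub z∈ with x , x∈ , refl ← ∈-map⁻ f (∈-deduplicate⁻ ℕ._≟_ (map f xs) z∈) =
    subst (_∈ _) (sym (f≡ x)) (∈-map⁺ φ (∈-deduplicate⁺ ℕ._≟_ (∈-map⁺ g (π∈ x∈))))

unique-same-elements⇒↭ : {xs ys : List A} → Unique xs → Unique ys →
                         (∀ {x} → x ∈ xs → x ∈ ys) → (∀ {x} → x ∈ ys → x ∈ xs) → xs ↭ ys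
unique-same-elements⇒↭ u v i o = ∼bag⇒↭ (unique∧set⇒bag u v (mk⇔ i o))

-- Neighborhoods and minimal labelings of one graph

module _ (G : Graph) where

  private module E = Inverse (enumeration G)

  ∈-vertices : ∀ v → v ∈ vertices G
  ∈-vertices v = subst (_∈ vertices G) (E.strictlyInverseˡ v) (∈-map⁺ E.to (∈-allFin (E.from v)))

  ∈-neighbors⁺ : ∀ {u v} → Adj G u v → v ∈ neighbors G u
  ∈-neighbors⁺ {u} {v} = ∈-filter⁺ (adj? G u) (∈-vertices v)

  ∈-neighbors⁻ : ∀ {u v} → v ∈ neighbors G u → Adj G u v
  ∈-neighbors⁻ {u} = proj₂ ∘ ∈-filter⁻ (adj? G u) {xs = vertices G}

  neighbors-! : ∀ u → Unique (neighbors G u)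
  neighbors-! u = Unique.filter⁺ (adj? G u)
    (Unique.map⁺ (Injection.injective (↔⇒↣ (enumeration G))) (Unique.allFin⁺ (order G)))

  degree>0 : ∀ u → 0 ℕ.< degree G u
  degree>0 u = ∈-length (∈-neighbors⁺ (proj₂ (no-isolated G u)))

  weight-cong : {f g : Vertex G → ℕ} → (∀ v → f v ≡ g v) → ∀ u → weight G f u ≡ weight G g u
  weight-cong eq u = cong sum (map-cong eq (neighbors G u))

  -- The two labelings are independent: `f` only certifies that the minimum exists, so any `g`
  -- bounds the value from above.
  χld-≤ : (f g : LDALabeling G) → χld G f ≤ #labelingWeights G g
  χld-≤ f = proj₂ (proj₂ (ldaChromaticNumber-exists G f))

  χld-achieved : (f : LDALabeling G) → ∃[ g ] #labelingWeights G g ≡ χld G f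
  χld-achieved f = proj₁ (proj₂ (ldaChromaticNumber-exists G f))

-- Transport of labelings along graph isomorphisms

record _≅_ (G H : Graph) : Set where
  field
    vertex : Vertex G ↔ Vertex H
  open Inverse vertex public
  field
    adj : ∀ u v → Adj G u v ⇔ Adj H (to u) (to v)

-- Lets the bound by the second factor follow from the construction that blows up the first.
×ᵍ-comm : ∀ G H → (G ×ᵍ H) ≅ (H ×ᵍ G)
×ᵍ-comm G H = record
  { vertex = ×-comm _ _
  ; adj    = λ _ _ → mk⇔ (λ (a , b) → b , a) (λ (b , a) → a , b)
  }

module _ {G H : Graph} (i : G ≅ H) where
  open _≅_ i

  neighbors-≅ : ∀ u → map to (neighbors G u) ↭ neighbors H (to u)
  neighbors-≅ u = unique-same-elements⇒↭
    (Unique.map⁺ (Injection.injective (↔⇒↣ vertex)) (neighbors-! G u)) (neighbors-! H (to u))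
    (λ z∈ → let v , v∈ , eq = ∈-map⁻ to z∈ in
      ∈-neighbors⁺ H (subst (Adj H (to u)) (sym eq) (Equivalence.to (adj u v) (∈-neighbors⁻ G v∈))))
    (λ {z} z∈ → subst (_∈ _) (strictlyInverseˡ z) (∈-map⁺ to (∈-neighbors⁺ G
      (Equivalence.from (adj u (from z))
        (subst (Adj H (to u)) (sym (strictlyInverseˡ z)) (∈-neighbors⁻ H z∈))))))

  weight-≅ : (f : Vertex H → ℕ) → ∀ u → weight G (f ∘ to) u ≡ weight H f (to u)
  weight-≅ f u = trans (cong sum (map-∘ (neighbors G u))) (sum-↭ (↭-map⁺ f (neighbors-≅ u)))

  order-≅ : order G ≡ order H
  order-≅ = ↔⇒≡ ((↔-sym (enumeration H) ↔-∘ vertex) ↔-∘ enumeration G)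

  labeling-≅ : (f : LDALabeling H) →
               Σ[ g ∈ LDALabeling G ] #labelingWeights G g ≤ #labelingWeights H f
  labeling-≅ f =
      record { bijection = ↔⇒⤖ bij
             ; proper = λ u v a eq → proper f (to u) (to v) (Equivalence.to (adj u v) a)
                 (trans (sym (weight-eq u)) (trans eq (weight-eq v))) }
    , #distinct-≤ _ (weight H (label f)) (λ w → w) to (vertices G) (vertices H)
        (λ {u} _ → ∈-vertices H (to u)) weight-eq
    where
    bij : Vertex G ↔ Fin (order G)
    -- The two orders are only propositionally equal, hence the cast; it keeps the underlying
    -- number, so labels and weights are those of `f`.
    bij = cast-id (sym order-≅) ↔-∘ (⤖⇒↔ (bijection f) ↔-∘ vertex)
    weight-eq : ∀ u → weight G (toLabel (Inverse.to bij)) u ≡ weight H (label f) (to u)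
    weight-eq u = trans (weight-cong G (λ v → cong suc (toℕ-cast (sym order-≅) _)) u)
                        (weight-≅ (label f) u)

-- Weights in a direct product as double sums

neighbors-× : ∀ G H x y →
  neighbors (G ×ᵍ H) (x , y) ↭ cartesianProduct (neighbors G x) (neighbors H y)
neighbors-× G H x y = unique-same-elements⇒↭
  (neighbors-! (G ×ᵍ H) (x , y)) (Unique.cartesianProduct⁺ (neighbors-! G x) (neighbors-! H y))
  (λ z∈ → let a , b = ∈-neighbors⁻ (G ×ᵍ H) z∈ in
    ∈-cartesianProduct⁺ (∈-neighbors⁺ G a) (∈-neighbors⁺ H b))
  (λ z∈ → let a , b = ∈-cartesianProduct⁻ (neighbors G x) (neighbors H y) z∈ in
    ∈-neighbors⁺ (G ×ᵍ H) (∈-neighbors⁻ G a , ∈-neighbors⁻ H b))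

weight-× : ∀ G H (f : Vertex (G ×ᵍ H) → ℕ) x y → weight (G ×ᵍ H) f (x , y) ≡
  sum (map (λ x′ → sum (map (λ y′ → f (x′ , y′)) (neighbors H y))) (neighbors G x))
weight-× G H f x y = trans (sum-↭ (↭-map⁺ f (neighbors-× G H x y)))
                           (sum-cartesianProduct f (neighbors G x) (neighbors H y))

-- Increasing and decreasing positions in a block

orient : ∀ {n} → Bool → Fin n → Fin n
orient true  = λ i → i
orient false = opposite

orient-involutive : ∀ {n} b (i : Fin n) → orient b (orient b i) ≡ i
orient-involutive true  i = refl
orient-involutive false i = opposite-involutive i

position : ∀ {n} → Bool → Fin n → ℕ
position b i = suc (toℕ (orient b i))

-- Counting from 1, a place at distance `i` from the front has position `i + 1`, and its mirror
-- image has position `n - i`.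
position-complementary : ∀ {n} (i : Fin n) → position true i + position false i ≡ suc n
position-complementary {n} i = begin
  suc (toℕ i) + suc (toℕ (opposite i))  ≡⟨ +-suc (suc (toℕ i)) _ ⟩
  suc (suc (toℕ i) + toℕ (opposite i))  ≡⟨ cong (λ j → suc (suc (toℕ i) + j)) (opposite-prop i) ⟩
  suc (suc (toℕ i) + (n ∸ suc (toℕ i))) ≡⟨ cong suc (m+[n∸m]≡n (toℕ<n i)) ⟩
  suc n                                 ∎
  where open ≡-Reasoning

-- The blow-up of a labeling and its weights

module _ (G : Graph) (c : Vertex G → Bool) {k : ℕ}
         (reds  : ∀ x → count c true  (neighbors G x) ≡ k)
         (blues : ∀ x → count c false (neighbors G x) ≡ k)
         (H : Graph) {s : ℕ} (regular : ∀ y → degree H y ≡ s)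
         (f : LDALabeling G) where

  private
    m : ℕ
    m = order H

    index : Vertex H → Fin m
    index = Inverse.from (enumeration H)

    -- Over each fixed `x` this is the enumeration of `H` followed by an involution, hence bijective
    -- even though the direction varies with `x`.
    shear : (Vertex G × Vertex H) ↔ (Vertex G × Fin m)
    shear = mk↔ₛ′
      (λ (x , y) → x , orient (c x) (index y))
      (λ (x , i) → x , Inverse.to (enumeration H) (orient (c x) i))
      (λ (x , i) → cong (x ,_) (trans
        (cong (orient (c x)) (Inverse.strictlyInverseʳ (enumeration H) _))
        (orient-involutive (c x) i)))
      (λ (x , y) → cong (x ,_) (trans
        (cong (Inverse.to (enumeration H)) (orient-involutive (c x) (index y)))
        (Inverse.strictlyInverseˡ (enumeration H) y)))

    -- The inverse of `*↔×` sends `(a , i)` to `m * a + i`, so the block of `a` is an interval of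
    -- `m` consecutive numbers.
    blowUp : Vertex (G ×ᵍ H) ↔ Fin (order G * m)
    blowUp = ↔-sym *↔× ↔-∘ ((⤖⇒↔ (bijection f) ×-↔ ↔-id (Fin m)) ↔-∘ shear)

    ℓ : Vertex (G ×ᵍ H) → ℕ
    ℓ = toLabel (Inverse.to blowUp)

    -- Labels and positions start at 1, so the block of `x` begins after `m * (label f x - 1)`;
    -- adding `m` on the left avoids the subtraction.
    cell : ∀ x y → ℓ (x , y) + m ≡ m * label f x + position (c x) (index y)
    cell x y = trans (cong (λ i → suc i + m) (toℕ-combine a i)) (rearrange m (toℕ a) (toℕ i))
      where
      a = Bijection.to (bijection f) x
      i = orient (c x) (index y)
      rearrange : ∀ m a i → suc (m * a + i) + m ≡ m * suc a + suc i
      rearrange = solve-∀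

    positions : Vertex H → Bool → ℕ
    positions y b = sum (map (position b ∘ index) (neighbors H y))

    positions-complementary : ∀ y → positions y true + positions y false ≡ s * suc m
    positions-complementary y = begin
      positions y true + positions y false
        ≡⟨ sum-map-+ _ _ (neighbors H y) ⟨
      sum (map (λ y′ → position true (index y′) + position false (index y′)) (neighbors H y))
        ≡⟨ weight-cong H (position-complementary ∘ index) y ⟩
      sum (map (λ _ → suc m) (neighbors H y))
        ≡⟨ sum-map-const (suc m) (neighbors H y) ⟩
      degree H y * suc m
        ≡⟨ cong (_* suc m) (regular y) ⟩
      s * suc m ∎
      where open ≡-Reasoning

    -- This is `cell` summed over the `s` neighbors of `y`. The row depends on `x` only through its
    -- label and its color.
    row : ∀ x y → weight H (λ y′ → ℓ (x , y′)) y + s * m ≡ s * m * label f x + positions y (c x)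
    row x y = begin
      weight H (λ y′ → ℓ (x , y′)) y + s * m
        ≡⟨ cong (weight H (λ y′ → ℓ (x , y′)) y +_) (sum-const m) ⟨
      weight H (λ y′ → ℓ (x , y′)) y + sum (map (λ _ → m) (neighbors H y))
        ≡⟨ sum-map-+ _ _ (neighbors H y) ⟨
      sum (map (λ y′ → ℓ (x , y′) + m) (neighbors H y))
        ≡⟨ weight-cong H (cell x) y ⟩
      sum (map (λ y′ → m * label f x + position (c x) (index y′)) (neighbors H y))
        ≡⟨ sum-map-+ _ _ (neighbors H y) ⟩
      sum (map (λ _ → m * label f x) (neighbors H y)) + positions y (c x)
        ≡⟨ cong (_+ positions y (c x)) (trans (sum-const _) (sym (*-assoc s m _))) ⟩
      s * m * label f x + positions y (c x) ∎
      where
      open ≡-Reasoning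
      sum-const : ∀ a → sum (map (λ _ → a) (neighbors H y)) ≡ s * a
      sum-const a = trans (sum-map-const a (neighbors H y)) (cong (_* a) (regular y))

    -- Rows are summed over the `k + k` neighbors of `x`. Of these, `k` run upwards and `k`
    -- downwards, so the position terms combine to `k` times a complementary pair, and the
    -- dependence on `y` disappears.
    weight-affine : ∀ x y → weight (G ×ᵍ H) ℓ (x , y) + (k + k) * (s * m) ≡
                            s * m * weight G (label f) x + k * (s * suc m)
    weight-affine x y = begin
      weight (G ×ᵍ H) ℓ (x , y) + (k + k) * (s * m)
        ≡⟨ cong₂ _+_ (weight-× G H ℓ x y) (cong (_* (s * m)) (sym degree≡k+k)) ⟩
      weight G rows x + degree G x * (s * m)
        ≡⟨ cong (weight G rows x +_) (sum-map-const (s * m) (neighbors G x)) ⟨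
      weight G rows x + sum (map (λ _ → s * m) (neighbors G x))
        ≡⟨ sum-map-+ _ _ (neighbors G x) ⟨
      sum (map (λ x′ → rows x′ + s * m) (neighbors G x))
        ≡⟨ weight-cong G (λ x′ → row x′ y) x ⟩
      sum (map (λ x′ → s * m * label f x′ + t (c x′)) (neighbors G x))
        ≡⟨ sum-map-+ _ _ (neighbors G x) ⟩
      sum (map (λ x′ → s * m * label f x′) (neighbors G x)) + sum (map (t ∘ c) (neighbors G x))
        ≡⟨ cong₂ _+_ (sum-map-* (s * m) (label f) (neighbors G x)) balanced ⟩
      s * m * weight G (label f) x + k * (s * suc m) ∎
      where
      open ≡-Reasoning
      rows = λ x′ → weight H (λ y′ → ℓ (x′ , y′)) y
      t = positions y
      degree≡k+k : degree G x ≡ k + k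
      degree≡k+k = trans (length-by-color c (neighbors G x)) (cong₂ _+_ (reds x) (blues x))
      balanced : sum (map (t ∘ c) (neighbors G x)) ≡ k * (s * suc m)
      balanced = begin
        sum (map (t ∘ c) (neighbors G x))
          ≡⟨ sum-by-color c t (neighbors G x) ⟩
        count c true (neighbors G x) * t true + count c false (neighbors G x) * t false
          ≡⟨ cong₂ _+_ (cong (_* t true) (reds x)) (cong (_* t false) (blues x)) ⟩
        k * t true + k * t false
          ≡⟨ *-distribˡ-+ k (t true) (t false) ⟨
        k * (t true + t false)
          ≡⟨ cong (k *_) (positions-complementary y) ⟩
        k * (s * suc m) ∎

    -- `weight-affine` solved for the weight. On weights of `f` the truncated subtraction is exact,
    -- since that equation exhibits the minuend as a sum containing the subtrahend.
    affine : ℕ → ℕ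
    affine w = s * m * w + k * (s * suc m) ∸ (k + k) * (s * m)

    weight-ℓ : ∀ v → weight (G ×ᵍ H) ℓ v ≡ affine (weight G (label f) (proj₁ v))
    weight-ℓ (x , y) = trans (sym (m+n∸n≡m _ ((k + k) * (s * m))))
                             (cong (_∸ (k + k) * (s * m)) (weight-affine x y))

    weight-ℓ-injective : ∀ u v → weight (G ×ᵍ H) ℓ u ≡ weight (G ×ᵍ H) ℓ v →
                         weight G (label f) (proj₁ u) ≡ weight G (label f) (proj₁ v)
    weight-ℓ-injective (x , y) (x′ , y′) eq =
      *-cancelˡ-≡ _ _ (s * m) (+-cancelʳ-≡ (k * (s * suc m)) _ _
        (trans (sym (weight-affine x y))
          (trans (cong (_+ (k + k) * (s * m)) eq) (weight-affine x′ y′))))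
      where instance
        -- The slope can be cancelled: `s` is positive because `y` is not isolated, and `m` because
        -- `index y` inhabits `Fin m`.
        s*m≢0 : NonZero (s * m)
        s*m≢0 = m*n≢0 s m {{>-nonZero (subst (0 ℕ.<_) (regular y) (degree>0 H y))}}
                          {{>-nonZero (≤-<-trans z≤n (toℕ<n (index y)))}}

  labeling-× : Σ[ h ∈ LDALabeling (G ×ᵍ H) ] #labelingWeights (G ×ᵍ H) h ≤ #labelingWeights G f
  labeling-× =
      record { bijection = ↔⇒⤖ blowUp
             -- Adjacent vertices of the product have adjacent first coordinates, so equal weights
             -- would contradict properness of `f`.
             ; proper = λ u v (a , _) eq → proper f _ _ a (weight-ℓ-injective u v eq) }
    , #distinct-≤ _ (weight G (label f)) affine proj₁ (vertices (G ×ᵍ H)) (vertices G)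
        (λ {v} _ → ∈-vertices G (proj₁ v)) weight-ℓ

-- The bound by each factor and by their minimum

labeling-×-χld : ∀ G H → EvenRegular G → NeighborhoodBalancedColoring G → EvenRegular H →
  (f : LDALabeling G) →
  Σ[ h ∈ LDALabeling (G ×ᵍ H) ] #labelingWeights (G ×ᵍ H) h ≤ χld G f
labeling-×-χld G H (r , divides k r≡k*2 , regular) (c , balanced) (_ , _ , regular′) f =
    -- The blow-up starts from a labeling `f′` attaining the minimum, not from the given `f`.
    let f′ , eq = χld-achieved G f
        h , le  = labeling-× G c reds (λ x → trans (sym (balanced x)) (reds x)) H regular′ f′
    in h , ≤-trans le (≤-reflexive eq)
  where
  reds : ∀ x → count c true (neighbors G x) ≡ k
  -- The two color classes of a neighborhood are equal in size and together have `r = k * 2`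
  -- elements, so each has `k`.
  reds x = *-cancelʳ-≡ _ k 2 (begin
    n * 2                             ≡⟨ double n ⟩
    n + n                             ≡⟨ cong (n +_) (balanced x) ⟩
    n + count c false (neighbors G x) ≡⟨ length-by-color c (neighbors G x) ⟨
    degree G x                        ≡⟨ regular x ⟩
    r                                 ≡⟨ r≡k*2 ⟩
    k * 2                             ∎)
    where
    open ≡-Reasoning
    n = count c true (neighbors G x)
    double : ∀ n → n * 2 ≡ n + n
    double = solve-∀

theorem5p3 : (G H : Graph) →
    EvenRegular G → EvenRegular H →
    NeighborhoodBalancedColoring G → NeighborhoodBalancedColoring H →
    (f : LDALabeling G) (g : LDALabeling H) →
    Σ[ h ∈ LDALabeling (G ×ᵍ H) ] (χld (G ×ᵍ H) h ≤ χld G f ⊓ χld H g)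
theorem5p3 G H erG erH nbcG nbcH f g =
  let h₁ , le₁ = labeling-×-χld G H erG nbcG erH f
      h₂ , le₂ = labeling-×-χld H G erH nbcH erG g
      -- `h₂` labels `H ×ᵍ G`; swapping coordinates makes it a labeling of `G ×ᵍ H`, comparable with
      -- the same minimum that `h₁` witnesses.
      h₃ , le₃ = labeling-≅ (×ᵍ-comm G H) h₂
  in h₁ , ⊓-glb (≤-trans (χld-≤ (G ×ᵍ H) h₁ h₁) le₁)
                (≤-trans (χld-≤ (G ×ᵍ H) h₁ h₃) (≤-trans le₃ le₂))
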